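{- Let $G=(V,E,\gamma_{id})$ be a connected vertex-coloured graph with $n$ vertices enumerated in $\{0,\dots,n-1\}$, where $\gamma_{id}$ is the constant colouring (all vertices have the same colour). Then iterated application of $\beta$-contraction, i.e. the sequence $G_0=G$, $G_{k+1}=G_k/\beta_k$ with $\beta_k$ the contraction mapping of $G_k$, converges to a graph with a single vertex, and the number of iterations needed is at most $$\lfloor \log_\varphi(n)\rfloor,\qquad \varphi=\frac{1+\sqrt5}{2}.$$
   Context: Graphs are finite, simple and undirected. One step of $\beta$-contraction of a vertex-coloured graph $G=(V,E,\gamma)$ with $V=\{0,\dots,n-1\}$ is defined as follows. Let $N_\gamma(v)=\{u\mid \{u,v\}\in E,\ \gamma(u)=\gamma(v)\}$ (for a constant colouring this is the usual neighbourhood). Put $\hat v=\min(N_\gamma(v)\cup\{v\})$ and let $D=(V,B)$ be the digraph with $B=\{(v,\hat v)\mid v\in V\}$. Disregarding self-loops and orientations, $D$ is a forest; each connected component $T$ of $D$ has root $r_T=\min V_T$, and $R$ denotes the set of all roots. Let $\pi:V\to R$ send $v$ to the root of the component of $D$ containing $v$, let $n'=|R|$, let $V'=\{0,\dots,n'-1\}$, and let $\alpha:R\to V'$ be the unique order-preserving bijection. The contraction mapping is $\beta=\alpha\circ\pi:V\to V'$. The contracted graph $G/\beta=(V',E',\gamma')$ has $E'=\{\{\beta(u),\beta(v)\}\mid \{u,v\}\in E,\ \beta(u)\ne\beta(v)\}$ and $\gamma'(\beta(v))=\gamma(v)$ for all $v\in V$. Its vertices are thus again enumerated in $\{0,\dots,n'-1\}$,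 so the step can be repeated. The number of iterations is the least $k$ for which $G_k$ has a single vertex. -}

module Defs where

open import Data.Empty using (⊥-elim)
open import Data.Fin.Base using (Fin; cast; _≤_; _<_)
open import Data.Fin.Induction using (<-wellFounded)
import Data.Fin.Properties as Fin
open import Data.Integer.Base using (+_)
open import Data.List.Base using (List; allFin; filter; length; lookup)
import Data.List.Extrema as Extrema
open import Data.List.Membership.Propositional using (_∈_)
open import Data.List.Membership.Propositional.Properties using (∈-filter⁺; ∈-filter⁻; ∈-allFin; ∈-lookup)
open import Data.List.Relation.Unary.All as All using ()
import Data.List.Relation.Unary.All.Properties as All
open import Data.List.Relation.Unary.AllPairs using (AllPairs; _∷_)
import Data.List.Relation.Unary.AllPairs.Properties as AllPairs
open import Data.List.Relation.Unary.Any using (index)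
open import Data.List.Relation.Unary.Any.Properties using (lookup-index)
open import Data.Nat.Base as ℕ using (ℕ; zero; suc)
open import Data.Product.Base using (∃; ∃-syntax; _×_; _,_; proj₁; proj₂)
open import Data.Rational.Base as ℚ using (ℚ; 0ℚ; 1ℚ; ½)
open import Data.Sum.Base using (_⊎_; inj₁; inj₂)
open import Function.Base using (_∘_)
open import Function.Bundles using (_⇔_)
open import Induction.WellFounded using (Acc; acc)
open import Level using (0ℓ)
open import Relation.Binary.Construct.Closure.Equivalence as Eq using (EqClosure)
open import Relation.Binary.Construct.Closure.ReflexiveTransitive using (Star; ε; _◅_)
open import Relation.Binary.Construct.Closure.Symmetric using (fwd)
open import Relation.Binary.Core using (Rel)
open import Relation.Binary.Definitions using (Decidable; DecidableEquality; Irreflexive; Symmetric; Tri; tri<; tri≈; tri>)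
open import Relation.Binary.PropositionalEquality
open import Relation.Nullary.Decidable using (Dec; yes; no; map′; _×-dec_; ¬?)

------------------------------------------------------------------------
-- Vertex-coloured graphs

record ColouredGraph (C : Set) : Set₁ where
  field
    order  : ℕ
    Adj    : Rel (Fin order) 0ℓ
    adj?   : Decidable Adj
    symm   : Symmetric Adj
    irrefl : Irreflexive _≡_ Adj
    colour : Fin order → C

open ColouredGraph public using (order)

-- The empty graph is not connected.

Connected : ∀ {C} → ColouredGraph C → Set
Connected G = order G ℕ.> 0 × (∀ u v → Star Adj u v)
  where open ColouredGraph G using (Adj)

ConstantColouring : ∀ {C} → ColouredGraph C → Set
ConstantColouring G = ∀ u v → colour u ≡ colour v
  where open ColouredGraph G using (colour)

-- Equality of enumerated coloured graphs: the identity on numbers, not an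
-- arbitrary bijection, has to be an isomorphism.

record _≋_ {C : Set} (G H : ColouredGraph C) : Set where
  private
    module G = ColouredGraph G
    module H = ColouredGraph H
  field
    order-≡  : G.order ≡ H.order
    adj-⇔    : ∀ u v → G.Adj u v ⇔ H.Adj (cast order-≡ u) (cast order-≡ v)
    colour-≡ : ∀ v → G.colour v ≡ H.colour (cast order-≡ v)

-- Convergence in a discrete space.

ConvergesTo : ∀ {C} → (ℕ → ColouredGraph C) → ColouredGraph C → Set
ConvergesTo 𝓖 H = ∃[ K ] ∀ k → K ℕ.≤ k → 𝓖 k ≋ H

------------------------------------------------------------------------
-- β-contraction

module Contraction {C : Set} (_≟_ : DecidableEquality C) (G : ColouredGraph C) where

  open ColouredGraph G hiding (order)

  private
    n : ℕ
    n = order G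

    V : Set
    V = Fin n

  open Extrema (Fin.≤-totalOrder n) using (min; min≤⊤; argmin-all)

  Nγ : V → V → Set
  Nγ v u = Adj v u × colour u ≡ colour v

  Nγ? : Decidable Nγ
  Nγ? v u = adj? v u ×-dec (colour u ≟ colour v)

  -- `min v us` is the least element of `us` together with `v`.

  hat : V → V
  hat v = min v (filter (Nγ? v) (allFin n))

  B : Rel V 0ℓ
  B v u = u ≡ hat v

  -- The components of the underlying undirected graph of D = (V , B).

  _~_ : Rel V 0ℓ
  _~_ = EqClosure B

  -- `_~_` is decidable: following B from a vertex ends in a fixed point of
  -- `hat`, and this fixed point determines the component.

  hat≤ : ∀ v → hat v ≤ v
  hat≤ v = min≤⊤ v (filter (Nγ? v) (allFin n))

  Sink : V → Set
  Sink v = ∃[ r ] hat r ≡ r × Star B v r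

  sink-acc : ∀ {v} → Acc _<_ v → Sink v
  sink-acc {v} (acc rec) = go (hat v Fin.≟ v)
    where
    go : Dec (hat v ≡ v) → Sink v
    go (yes fixed) = v , fixed , ε
    go (no  moved) =
      let r , fixed , path = sink-acc (rec (Fin.≤∧≢⇒< (hat≤ v) moved))
      in  r , fixed , refl ◅ path

  sink : ∀ v → Sink v
  sink v = sink-acc (<-wellFounded v)

  fixed-path : ∀ {v r} → hat v ≡ v → Star B v r → v ≡ r
  fixed-path _     ε             = refl
  fixed-path fixed (refl ◅ path) = trans (sym fixed) (fixed-path (cong hat fixed) path)

  sink-unique : ∀ {v r s} → hat r ≡ r → hat s ≡ s → Star B v r → Star B v s → r ≡ s
  sink-unique fr fs ε          q          = fixed-path fr q
  sink-unique fr fs (p ◅ ps)   ε          = sym (fixed-path fs (p ◅ ps))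
  sink-unique fr fs (refl ◅ p) (refl ◅ q) = sink-unique fr fs p q

  sink-B : ∀ {v u} → B v u → proj₁ (sink v) ≡ proj₁ (sink u)
  sink-B {v} refl =
    let _ , fr , p = sink v
        _ , fs , q = sink (hat v)
    in  sink-unique fr fs p (refl ◅ q)

  ~sink : ∀ v → v ~ proj₁ (sink v)
  ~sink v = go (proj₂ (proj₂ (sink v)))
    where
    go : ∀ {u w} → Star B u w → u ~ w
    go ε        = ε
    go (p ◅ ps) = fwd p ◅ go ps

  _~?_ : Decidable _~_
  u ~? v = map′ to (Eq.gfold isEquivalence (proj₁ ∘ sink) sink-B) (proj₁ (sink u) Fin.≟ proj₁ (sink v))
    where
    to : proj₁ (sink u) ≡ proj₁ (sink v) → u ~ v
    to eq = Eq.transitive B (~sink u) (subst (_~ v) (sym eq) (Eq.symmetric B (~sink v)))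

  π : V → V
  π v = min v (filter (v ~?_) (allFin n))

  IsRoot : V → Set
  IsRoot r = ∃[ v ] π v ≡ r

  isRoot? : ∀ r → Dec (IsRoot r)
  isRoot? r = Fin.any? (λ v → π v Fin.≟ r)

  -- R in increasing order, so α sends a root to its position in this list.

  roots : List V
  roots = filter isRoot? (allFin n)

  n′ : ℕ
  n′ = length roots

  V′ : Set
  V′ = Fin n′

  root∈roots : ∀ {r} → IsRoot r → r ∈ roots
  root∈roots p = ∈-filter⁺ isRoot? (∈-allFin _) p

  α : ∀ {r} → IsRoot r → V′
  α p = index (root∈roots p)

  α⁻¹ : V′ → V
  α⁻¹ = lookup roots

  β : V → V′
  β v = α (v , refl)

  E′ : Rel V′ 0ℓ
  E′ a b = a ≢ b × ∃[ u ] ∃[ v ] Adj u v × β u ≡ a × β v ≡ b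

  E′? : Decidable E′
  E′? a b = ¬? (a Fin.≟ b) ×-dec Fin.any? λ u → Fin.any? λ v →
    adj? u v ×-dec (β u Fin.≟ a) ×-dec (β v Fin.≟ b)

  γ′ : V′ → C
  γ′ = colour ∘ α⁻¹

  contracted : ColouredGraph C
  contracted = record
    { order  = n′
    ; Adj    = E′
    ; adj?   = E′?
    ; symm   = λ { (a≢b , u , v , uv , βu , βv) → a≢b ∘ sym , v , u , symm uv , βv , βu }
    ; irrefl = λ { a≡b (a≢b , _) → a≢b a≡b }
    ; colour = γ′
    }

  -- α is an order-preserving bijection between R and V′, and γ′ satisfies
  -- its defining equation.

  α⁻¹-isRoot : ∀ a → IsRoot (α⁻¹ a)
  α⁻¹-isRoot a = proj₂ (∈-filter⁻ isRoot? {xs = allFin n} (∈-lookup {xs = roots} a))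

  α⁻¹∘α : ∀ {r} (p : IsRoot r) → α⁻¹ (α p) ≡ r
  α⁻¹∘α p = sym (lookup-index (root∈roots p))

  α⁻¹-mono-< : ∀ {a b} → a < b → α⁻¹ a < α⁻¹ b
  α⁻¹-mono-< = lookup-mono (AllPairs.filter⁺ isRoot? (AllPairs.tabulate⁺-< (λ i<j → i<j)))
    where
    lookup-mono : ∀ {vs} → AllPairs _<_ vs → ∀ {a b} → a < b → lookup vs a < lookup vs b
    lookup-mono (v<vs ∷ _)  {Fin.zero}  {Fin.suc b} _         = All.lookup v<vs (∈-lookup b)
    lookup-mono (_    ∷ vs) {Fin.suc a} {Fin.suc b} (ℕ.s≤s p) = lookup-mono vs p

  α-mono-< : ∀ {r s} (p : IsRoot r) (q : IsRoot s) → r < s → α p < α q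
  α-mono-< {r} {s} p q r<s = go (Fin.<-cmp (α p) (α q))
    where
    go : Tri (α p < α q) (α p ≡ α q) (α q < α p) → α p < α q
    go (tri< lt _ _) = lt
    go (tri≈ _ eq _) = ⊥-elim (Fin.<-irrefl (trans (sym (α⁻¹∘α p)) (trans (cong α⁻¹ eq) (α⁻¹∘α q))) r<s)
    go (tri> _ _ gt) = ⊥-elim (Fin.<-asym r<s (subst₂ _<_ (α⁻¹∘α q) (α⁻¹∘α p) (α⁻¹-mono-< gt)))

  α∘α⁻¹ : ∀ a → α (α⁻¹-isRoot a) ≡ a
  α∘α⁻¹ a = go (Fin.<-cmp (α (α⁻¹-isRoot a)) a)
    where
    b : V′
    b = α (α⁻¹-isRoot a)

    go : Tri (b < a) (b ≡ a) (a < b) → b ≡ a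
    go (tri< lt _ _) = ⊥-elim (Fin.<-irrefl (α⁻¹∘α (α⁻¹-isRoot a)) (α⁻¹-mono-< lt))
    go (tri≈ _ eq _) = eq
    go (tri> _ _ gt) = ⊥-elim (Fin.<-irrefl (sym (α⁻¹∘α (α⁻¹-isRoot a))) (α⁻¹-mono-< gt))

  ~π : ∀ v → v ~ π v
  ~π v = argmin-all (λ u → u) {P = v ~_} ε (All.all-filter (v ~?_) (allFin n))

  colour-hat : ∀ v → colour (hat v) ≡ colour v
  colour-hat v = argmin-all (λ u → u) {P = λ u → colour u ≡ colour v} refl
    (All.map proj₂ (All.all-filter (Nγ? v) (allFin n)))

  γ′∘β : ∀ v → γ′ (β v) ≡ colour v
  γ′∘β v = trans (cong colour (α⁻¹∘α (v , refl)))
    (sym (Eq.gfold isEquivalence colour (λ { {u} refl → sym (colour-hat u) }) (~π v)))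

module _ {C : Set} (_≟_ : DecidableEquality C) where

  _/β : ColouredGraph C → ColouredGraph C
  G /β = Contraction.contracted _≟_ G

  iterated : ColouredGraph C → ℕ → ColouredGraph C
  iterated G zero    = G
  iterated G (suc k) = iterated G k /β

  IsNumberOfIterations : ColouredGraph C → ℕ → Set
  IsNumberOfIterations G k =
    order (iterated G k) ≡ 1 × (∀ j → j ℕ.< k → order (iterated G j) ≢ 1)

------------------------------------------------------------------------
-- The ordered field ℚ(√5)

infix 6 _+_√5

record ℚ[√5] : Set where
  constructor _+_√5
  field
    rational   : ℚ
    irrational : ℚ

infixl 7 _*_
infixl 6 _-_
infixr 8 _^_
infix  4 _≤√5_ _<√5_

fromℕ : ℕ → ℚ[√5]
fromℕ n = (+ n ℚ./ 1) + 0ℚ √5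

_-_ : ℚ[√5] → ℚ[√5] → ℚ[√5]
(a + b √5) - (c + d √5) = (a ℚ.- c) + (b ℚ.- d) √5

5ℚ : ℚ
5ℚ = + 5 ℚ./ 1

_*_ : ℚ[√5] → ℚ[√5] → ℚ[√5]
(a + b √5) * (c + d √5) = (a ℚ.* c ℚ.+ 5ℚ ℚ.* (b ℚ.* d)) + (a ℚ.* d ℚ.+ b ℚ.* c) √5

_^_ : ℚ[√5] → ℕ → ℚ[√5]
x ^ zero  = fromℕ 1
x ^ suc k = x * x ^ k

-- The order inherited from ℝ, where √5 > 0: a + b√5 ≥ 0 means that
-- a ≥ |b|√5 or b√5 ≥ |a|.

NonNegative : ℚ[√5] → Set
NonNegative (a + b √5) =
  (0ℚ ℚ.≤ a × 5ℚ ℚ.* (b ℚ.* b) ℚ.≤ a ℚ.* a) ⊎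
  (0ℚ ℚ.≤ b × a ℚ.* a ℚ.≤ 5ℚ ℚ.* (b ℚ.* b))

_≤√5_ : Rel ℚ[√5] 0ℓ
x ≤√5 y = NonNegative (y - x)

_<√5_ : Rel ℚ[√5] 0ℓ
x <√5 y = x ≤√5 y × x ≢ y

φ : ℚ[√5]
φ = ½ + ½ √5

-- m = ⌊ log_φ n ⌋, that is m ≤ log_φ n < m + 1, for n ≥ 1; both
-- inequalities are exponentiated to base φ > 1.

IsFloorLogφ : ℕ → ℕ → Set
IsFloorLogφ n m = φ ^ m ≤√5 fromℕ n × fromℕ n <√5 φ ^ suc m

{-# OPTIONS --safe #-}

-- Write n_k for the order of the k-th graph.  The key inequality is
-- n_k ≥ n_{k+1} + n_{k+2} whenever n_k ≠ 1.  Indeed n_{k+1} counts the roots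
-- of G_k.  A root of G_{k+1} comes from a root r of G_k, and every neighbour u
-- of r satisfies π(u) ≤ û ≤ r, hence π(u) = r, for otherwise π(u) would give r
-- a smaller neighbour in G_{k+1}.  So each root of G_{k+1} owns a non-root of
-- G_k, and there are n_k − n_{k+1} of those.  Read backwards from n_k = 1, the
-- orders grow at least like the Fibonacci numbers, and these dominate φ^k.

module Submission where

open import Defs
open import Data.Nat.Base using (ℕ; _≤_)
open import Data.Product.Base using (∃-syntax; _×_)
open import Relation.Binary.Definitions using (DecidableEquality)
open import Relation.Binary.PropositionalEquality using (_≡_)

open import Data.Empty using (⊥-elim)
open import Data.Fin.Base as Fin using (Fin; join; splitAt)
import Data.Fin.Properties as Fin
open import Data.Integer.Base as ℤ using (+_)
import Data.Integer.Properties as ℤ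
open import Data.List.Base using (allFin; filter)
import Data.List.Extrema as Extrema
open import Data.List.Membership.Propositional.Properties using (∈-allFin; ∈-filter⁺)
import Data.List.Relation.Unary.All as All
open import Data.Nat.Base as ℕ using (zero; suc; z≤n; s≤s)
open import Data.Nat.Induction using (<-wellFounded)
import Data.Nat.Properties as ℕ
open import Data.Product.Base using (_,_; proj₁; proj₂)
open import Data.Rational.Base as ℚ using (ℚ; 0ℚ; ½)
import Data.Rational.Properties as ℚ
open import Data.Rational.Solver using (module +-*-Solver)
import Data.Rational.Unnormalised.Base as ℚᵘ
import Data.Rational.Unnormalised.Properties as ℚᵘ
open import Data.Sum.Base using (_⊎_; inj₁; inj₂; [_,_]′)
open import Function.Base using (_∘_)
open import Function.Bundles using (mk⇔)
open import Function.Definitions using (Injective)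
open import Induction.WellFounded using (Acc; acc)
import Relation.Binary.Construct.Closure.Equivalence as Eq
open import Relation.Binary.Construct.Closure.ReflexiveTransitive using (Star; ε; _◅_; return)
open import Relation.Binary.Construct.Closure.Symmetric using (fwd)
open import Relation.Binary.Definitions using (Tri; tri<; tri≈; tri>)
open import Relation.Binary.PropositionalEquality
open import Relation.Nullary using (Dec; ¬_; yes; no; contradiction)

⊎-injection⇒+≤ : ∀ {m n o} {f : Fin m ⊎ Fin n → Fin o} → Injective _≡_ _≡_ f → m ℕ.+ n ≤ o
⊎-injection⇒+≤ {m} {n} {f = f} f-injective = Fin.injective⇒≤ {f = f ∘ splitAt m} λ {i} {j} eq →
  trans (sym (Fin.join-splitAt m n i)) (trans (cong (join m n) (f-injective eq)) (Fin.join-splitAt m n j))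

Fin1-unique : ∀ {n} → n ≡ 1 → (u v : Fin n) → u ≡ v
Fin1-unique refl Fin.zero Fin.zero = refl

-- Roots and components in a single contraction

module ContractionProperties {C : Set} (_≟_ : DecidableEquality C) (G : ColouredGraph C) where

  open ColouredGraph G using (Adj) renaming (order to n)
  open Contraction _≟_ G
  open Extrema (Fin.≤-totalOrder n) using (min≤xs)

  hat≤neighbour : ∀ {v u} → Nγ v u → hat v Fin.≤ u
  hat≤neighbour {v} {u} vu = All.lookup (min≤xs v (filter (Nγ? v) (allFin n))) (∈-filter⁺ (Nγ? v) (∈-allFin u) vu)

  π≤~ : ∀ {v u} → v ~ u → π v Fin.≤ u
  π≤~ {v} {u} v~u = All.lookup (min≤xs v (filter (v ~?_) (allFin n))) (∈-filter⁺ (v ~?_) (∈-allFin u) v~u)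

  π-mono-~ : ∀ {v u} → v ~ u → π v Fin.≤ π u
  π-mono-~ {v} {u} v~u = π≤~ (Eq.transitive B v~u (~π u))

  π-cong : ∀ {v u} → v ~ u → π v ≡ π u
  π-cong v~u = Fin.≤-antisym (π-mono-~ v~u) (π-mono-~ (Eq.symmetric B v~u))

  root⇒π-fixed : ∀ {r} → IsRoot r → π r ≡ r
  root⇒π-fixed (v , refl) = sym (π-cong (~π v))

  ~hat : ∀ v → v ~ hat v
  ~hat v = return (fwd refl)

  -- A root is least in its component, and `hat r` lies in that component, so `hat` cannot move it
  -- down.
  root⇒hat-fixed : ∀ {r} → IsRoot r → hat r ≡ r
  root⇒hat-fixed {r} root = Fin.≤-antisym (hat≤ r)
    (subst (Fin._≤ hat r) (root⇒π-fixed root) (π≤~ (~hat r)))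

  α⁻¹∘β : ∀ v → α⁻¹ (β v) ≡ π v
  α⁻¹∘β v = α⁻¹∘α (v , refl)

  β-surjective : ∀ a → ∃[ v ] β v ≡ a
  β-surjective a = proj₁ (α⁻¹-isRoot a) , trans (β≡α (α⁻¹-isRoot a)) (α∘α⁻¹ a)
    where
    -- A proof of `IsRoot r` stores a vertex `v` with `π v ≡ r`; matching on the equation turns
    -- `α p` into `β v`.
    β≡α : ∀ {r} (p : IsRoot r) → β (proj₁ p) ≡ α p
    β≡α (v , refl) = refl

  α⁻¹-injective : Injective _≡_ _≡_ α⁻¹
  α⁻¹-injective {a} {b} eq = by (Fin.<-cmp a b)
    where
    by : Tri (a Fin.< b) (a ≡ b) (b Fin.< a) → a ≡ b
    by (tri< a<b _ _) = contradiction (α⁻¹-mono-< a<b) (Fin.<-irrefl eq)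
    by (tri≈ _ a≡b _) = a≡b
    by (tri> _ _ b<a) = contradiction (α⁻¹-mono-< b<a) (Fin.<-irrefl (sym eq))

  α⁻¹-mono-≤ : ∀ {a b} → a Fin.≤ b → α⁻¹ a Fin.≤ α⁻¹ b
  α⁻¹-mono-≤ {a} {b} a≤b = by (a Fin.≟ b)
    where
    by : Dec (a ≡ b) → α⁻¹ a Fin.≤ α⁻¹ b
    by (yes a≡b) = Fin.≤-reflexive (cong α⁻¹ a≡b)
    by (no  a≢b) = ℕ.<⇒≤ (α⁻¹-mono-< (Fin.≤∧≢⇒< a≤b a≢b))

  n′≤n : n′ ≤ n
  n′≤n = Fin.injective⇒≤ {f = α⁻¹} α⁻¹-injective

  -- Paths survive under `β` once the edges whose ends have equal images are dropped; surjectivity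
  -- of `β` then covers all pairs of vertices.
  contracted-connected : Connected G → Connected contracted
  contracted-connected (n>0 , path) = Fin>0 (β (Fin.fromℕ< n>0)) , path′
    where
    Fin>0 : ∀ {m} → Fin m → m ℕ.> 0
    Fin>0 Fin.zero    = s≤s z≤n
    Fin>0 (Fin.suc _) = s≤s z≤n

    contract-path : ∀ {u v} → Star Adj u v → Star E′ (β u) (β v)
    contract-path ε = ε
    contract-path {u} {v} (_◅_ {j = w} uw ps) = step (β u Fin.≟ β w)
      where
      step : Dec (β u ≡ β w) → Star E′ (β u) (β v)
      step (yes eq) = subst (λ a → Star E′ a (β v)) (sym eq) (contract-path ps)
      step (no  ne) = (ne , u , w , uw , refl , refl) ◅ contract-path ps

    path′ : ∀ a b → Star E′ a b
    path′ a b = let u , βu≡a = β-surjective a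
                    v , βv≡b = β-surjective b
                in  subst₂ (Star E′) βu≡a βv≡b (contract-path (path u v))

-- Loss of vertices over two contractions

neighbour : ∀ {C} (G : ColouredGraph C) → Connected G → order G ≢ 1 →
            ∀ v → ∃[ u ] ColouredGraph.Adj G v u
neighbour G (n>0 , path) n≢1 v = let w , v≢w = other n≢1 v in first (path v w) v≢w
  where
  open ColouredGraph G using (Adj)

  other : ∀ {n} → n ≢ 1 → (v : Fin n) → ∃[ w ] v ≢ w
  other {suc zero}    n≢1 _           = contradiction refl n≢1
  other {suc (suc _)} _   Fin.zero    = Fin.suc Fin.zero , λ ()
  other {suc (suc _)} _   (Fin.suc _) = Fin.zero , λ ()

  first : ∀ {v w} → Star Adj v w → v ≢ w → ∃[ u ] Adj v u
  first ε        v≢v = contradiction refl v≢v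
  first (vu ◅ _) _   = _ , vu

module _ {C : Set} (_≟_ : DecidableEquality C) where

  order-/β² : ∀ G → Connected G → ConstantColouring G → order G ≢ 1 →
              order (_/β _≟_ G) ℕ.+ order (_/β _≟_ (_/β _≟_ G)) ≤ order G
  order-/β² G connected constant n≢1 = ⊎-injection⇒+≤ {f = f} f-injective
    where
    open ColouredGraph G using (Adj; irrefl; symm)
    module K  = Contraction _≟_ G
    module K′ = Contraction _≟_ K.contracted
    module P  = ContractionProperties _≟_ G
    module P′ = ContractionProperties _≟_ K.contracted

    root : K′.V′ → Fin (order G)
    root = K.α⁻¹ ∘ K′.α⁻¹

    π-neighbour : ∀ c {u} → Adj (root c) u → K.π u ≡ root c
    π-neighbour c {u} ru = Fin.≤-antisym πu≤r r≤πu
      where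
      a = K′.α⁻¹ c

      πu≤r : K.π u Fin.≤ root c
      πu≤r = Fin.≤-trans (P.π≤~ (P.~hat u)) (P.hat≤neighbour (symm ru , constant _ _))

      β-root : K.β (root c) ≡ a
      β-root = P.α⁻¹-injective (trans (P.α⁻¹∘β _) (P.root⇒π-fixed (K.α⁻¹-isRoot a)))

      a≤βu : a Fin.≤ K.β u
      a≤βu = by (a Fin.≟ K.β u)
        where
        by : Dec (a ≡ K.β u) → a Fin.≤ K.β u
        by (yes eq)  = Fin.≤-reflexive eq
        -- `γ′` takes its values among the colours of `G`, so `constant` applies to the contracted
        -- graph as well.
        by (no  a≢b) = subst (Fin._≤ K.β u) (P′.root⇒hat-fixed (K′.α⁻¹-isRoot c))
          (P′.hat≤neighbour ((a≢b , root c , u , ru , β-root , refl) , constant _ _))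

      r≤πu : root c Fin.≤ K.π u
      r≤πu = subst (root c Fin.≤_) (P.α⁻¹∘β u) (P.α⁻¹-mono-≤ a≤βu)

    child : K′.V′ → Fin (order G)
    child c = proj₁ (neighbour G connected n≢1 (root c))

    π-child : ∀ c → K.π (child c) ≡ root c
    π-child c = π-neighbour c (proj₂ (neighbour G connected n≢1 (root c)))

    -- As a root, `child c` would be fixed by `π` and hence equal to its own neighbour `root c`.
    child-notRoot : ∀ c → ¬ K.IsRoot (child c)
    child-notRoot c isRoot = irrefl (trans (sym (π-child c)) (P.root⇒π-fixed isRoot))
                                    (proj₂ (neighbour G connected n≢1 (root c)))

    f : K.V′ ⊎ K′.V′ → Fin (order G)
    f = [ K.α⁻¹ , child ]′

    f-injective : Injective _≡_ _≡_ f
    f-injective {inj₁ _} {inj₁ _} eq = cong inj₁ (P.α⁻¹-injective eq)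
    f-injective {inj₁ a} {inj₂ c} eq = contradiction (subst K.IsRoot eq (K.α⁻¹-isRoot a)) (child-notRoot c)
    f-injective {inj₂ c} {inj₁ a} eq = contradiction (subst K.IsRoot (sym eq) (K.α⁻¹-isRoot a)) (child-notRoot c)
    -- `π` recovers `root c` from `child c`, and `root` is a composite of injections.
    f-injective {inj₂ c} {inj₂ d} eq = cong inj₂ (P′.α⁻¹-injective (P.α⁻¹-injective
      (trans (sym (π-child c)) (trans (cong K.π eq) (π-child d)))))

  -- Invariants of the iteration

  iterated-connected : ∀ G → Connected G → ∀ k → Connected (iterated _≟_ G k)
  iterated-connected G connected zero    = connected
  iterated-connected G connected (suc k) =
    ContractionProperties.contracted-connected _≟_ (iterated _≟_ G k) (iterated-connected G connected k)

  -- Each step pulls colours back along `α⁻¹`, so the composite of these maps supplies `w`.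
  iterated-colour : ∀ G k v → ∃[ w ] ColouredGraph.colour (iterated _≟_ G k) v ≡ ColouredGraph.colour G w
  iterated-colour G zero    v = v , refl
  iterated-colour G (suc k) v =
    iterated-colour G k (Contraction.α⁻¹ _≟_ (iterated _≟_ G k) v)

  -- Two indices are needed because convergence compares different members of the sequence.
  iterated-colours-equal : ∀ G → ConstantColouring G → ∀ k l u v →
    ColouredGraph.colour (iterated _≟_ G k) u ≡ ColouredGraph.colour (iterated _≟_ G l) v
  iterated-colours-equal G constant k l u v =
    let u′ , eq  = iterated-colour G k u
        v′ , eq′ = iterated-colour G l v
    in  trans eq (trans (constant u′ v′) (sym eq′))

  -- Contraction never increases the order, and connectedness keeps it positive.
  order≡1-stable : ∀ G → Connected G → ∀ {K} → order (iterated _≟_ G K) ≡ 1 →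
                   ∀ {k} → K ℕ.≤′ k → order (iterated _≟_ G k) ≡ 1
  order≡1-stable G connected single ℕ.≤′-refl = single
  order≡1-stable G connected single (ℕ.≤′-step {k} K≤k) = ℕ.≤-antisym
    (ℕ.≤-trans (ContractionProperties.n′≤n _≟_ (iterated _≟_ G k))
               (ℕ.≤-reflexive (order≡1-stable G connected single K≤k)))
    (proj₁ (iterated-connected G connected (suc k)))

-- Any edge on a single vertex would be a loop, so both adjacency relations are empty.
single-vertex-≋ : ∀ {C} (G H : ColouredGraph C) → order G ≡ 1 → order H ≡ 1 →
                  (∀ u v → ColouredGraph.colour G u ≡ ColouredGraph.colour H v) → G ≋ H
single-vertex-≋ G H G≡1 H≡1 colours = record
  { order-≡  = trans G≡1 (sym H≡1)
  ; adj-⇔    = λ u v → mk⇔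
      (λ uv → ⊥-elim (G.irrefl (Fin1-unique G≡1 _ _) uv))
      (λ uv → ⊥-elim (H.irrefl (Fin1-unique H≡1 _ _) uv))
  ; colour-≡ = λ v → colours v _
  }
  where
  module G = ColouredGraph G
  module H = ColouredGraph H

-- Fibonacci growth

-- fib j is the Fibonacci number F_{j-1} in the usual indexing, so that
-- φ^j = fib j + fib (j+1) φ for all j ≥ 0.
fib : ℕ → ℕ
fib 0             = 1
fib 1             = 0
fib (suc (suc j)) = fib (suc j) ℕ.+ fib j

fib-positive : ∀ j → 1 ≤ fib (2 ℕ.+ j)
fib-positive zero    = s≤s z≤n
fib-positive (suc j) = ℕ.≤-trans (fib-positive j) (ℕ.m≤m+n _ _)

-- A crude bound, enough to find some power of φ above `n` from which the search for the floor is
-- bounded.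
n≤fib : ∀ n → n ≤ fib (2 ℕ.+ n)
n≤fib zero          = z≤n
n≤fib (suc zero)    = s≤s z≤n
n≤fib (suc (suc n)) =
  subst (_≤ fib (4 ℕ.+ n)) (ℕ.+-comm (suc n) 1) (ℕ.+-mono-≤ (n≤fib (suc n)) (fib-positive n))

-- While `s 0 ≢ 1`, positivity of `s 2` forces `s 1 < s 0`. Recursion on the value `s 0`, passing to
-- the shifted sequence, therefore reaches 1.
fib-descent : (s : ℕ → ℕ) → (∀ i → 1 ≤ s i) → (∀ i → s i ≢ 1 → s (1 ℕ.+ i) ℕ.+ s (2 ℕ.+ i) ≤ s i) →
              ∃[ k ] (s k ≡ 1 × (∀ j → j ℕ.< k → s j ≢ 1)) × fib (3 ℕ.+ k) ≤ s 0
fib-descent s positive descent =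
  let k , least , bound , _ = go s positive descent (<-wellFounded (s 0)) in k , least , bound
  where
  -- The bound on s 1 makes the induction go through.
  go : (s : ℕ → ℕ) → (∀ i → 1 ≤ s i) → (∀ i → s i ≢ 1 → s (1 ℕ.+ i) ℕ.+ s (2 ℕ.+ i) ≤ s i) →
       Acc ℕ._<_ (s 0) →
       ∃[ k ] (s k ≡ 1 × (∀ j → j ℕ.< k → s j ≢ 1)) × fib (3 ℕ.+ k) ≤ s 0 × fib (2 ℕ.+ k) ≤ s 1
  go s positive descent (acc rec) with s 0 ℕ.≟ 1
  -- `fib 3` and `fib 2` both equal 1.
  ... | yes single = 0 , (single , λ _ ()) , positive 0 , positive 1
  ... | no  ¬single =
    let s₁+s₂≤s₀ = descent 0 ¬single
        s₁<s₀ = ℕ.<-≤-trans (ℕ.m<m+n (s 1) (positive 2)) s₁+s₂≤s₀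
        k , (single , least) , bound₁ , bound₂ = go (s ∘ suc) (positive ∘ suc) (descent ∘ suc) (rec s₁<s₀)
    in  suc k
      , (single , λ { zero _ → ¬single ; (suc j) (s≤s j<k) → least j j<k })
      -- `fib (4 + k)` unfolds to `fib (3 + k) + fib (2 + k)`, whose terms are bounded by `s 1` and
      -- `s 2`.
      , ℕ.≤-trans (ℕ.+-mono-≤ bound₁ bound₂) s₁+s₂≤s₀
      , bound₁

-- Natural numbers among the rationals

ι : ℕ → ℚ
ι n = + n ℚ./ 1

-- Sums in `ℚ` are normalised and do not compute on variables. Over unnormalised fractions with
-- denominator 1 only an integer identity remains.
ι-+ : ∀ m n → ι (m ℕ.+ n) ≡ ι m ℚ.+ ι n
ι-+ m n = ℚ.toℚᵘ-injective (begin
  ℚ.toℚᵘ (ι (m ℕ.+ n))                     ≈⟨ ℚ.toℚᵘ-fromℚᵘ (ℚᵘ.mkℚᵘ (+ (m ℕ.+ n)) 0) ⟩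
  ℚᵘ.mkℚᵘ (+ (m ℕ.+ n)) 0                  ≈⟨ ℚᵘ.*≡* (cong (ℤ._* + 1) (sym (cong₂ ℤ._+_ (ℤ.*-identityʳ (+ m)) (ℤ.*-identityʳ (+ n))))) ⟩
  ℚᵘ.mkℚᵘ (+ m) 0 ℚᵘ.+ ℚᵘ.mkℚᵘ (+ n) 0     ≈⟨ ℚᵘ.+-cong (ℚ.toℚᵘ-fromℚᵘ (ℚᵘ.mkℚᵘ (+ m) 0)) (ℚ.toℚᵘ-fromℚᵘ (ℚᵘ.mkℚᵘ (+ n) 0)) ⟨
  ℚ.toℚᵘ (ι m) ℚᵘ.+ ℚ.toℚᵘ (ι n)           ≈⟨ ℚ.toℚᵘ-homo-+ (ι m) (ι n) ⟨
  ℚ.toℚᵘ (ι m ℚ.+ ι n)                     ∎)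
  where open ℚᵘ.≃-Reasoning

ι-mono-≤ : ∀ {m n} → m ≤ n → ι m ℚ.≤ ι n
ι-mono-≤ {m} {n} m≤n = ℚ.toℚᵘ-cancel-≤ (begin
  ℚ.toℚᵘ (ι m)     ≃⟨ ℚ.toℚᵘ-fromℚᵘ (ℚᵘ.mkℚᵘ (+ m) 0) ⟩
  ℚᵘ.mkℚᵘ (+ m) 0  ≤⟨ ℚᵘ.*≤* (ℤ.*-monoʳ-≤-nonNeg (+ 1) (ℤ.+≤+ m≤n)) ⟩
  ℚᵘ.mkℚᵘ (+ n) 0  ≃⟨ ℚ.toℚᵘ-fromℚᵘ (ℚᵘ.mkℚᵘ (+ n) 0) ⟨
  ℚ.toℚᵘ (ι n)     ∎)
  where open ℚᵘ.≤-Reasoning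

0≤ι : ∀ n → 0ℚ ℚ.≤ ι n
0≤ι n = ι-mono-≤ {0} {n} z≤n

0≤p+q : ∀ {p q} → 0ℚ ℚ.≤ p → 0ℚ ℚ.≤ q → 0ℚ ℚ.≤ p ℚ.+ q
0≤p+q = ℚ.+-mono-≤

0≤p*q : ∀ {p q} → 0ℚ ℚ.≤ p → 0ℚ ℚ.≤ q → 0ℚ ℚ.≤ p ℚ.* q
0≤p*q {p} {q} 0≤p 0≤q = subst (ℚ._≤ p ℚ.* q) (ℚ.*-zeroʳ p)
  (ℚ.*-monoˡ-≤-nonNeg p {{ℚ.nonNegative 0≤p}} 0≤q)

p≤q⇒0≤q-p : ∀ {p q} → p ℚ.≤ q → 0ℚ ℚ.≤ q ℚ.- p
p≤q⇒0≤q-p {p} {q} p≤q = subst (ℚ._≤ q ℚ.- p) (ℚ.+-inverseʳ p) (ℚ.+-monoˡ-≤ (ℚ.- p) p≤q)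

0≤q-p⇒p≤q : ∀ {p q} → 0ℚ ℚ.≤ q ℚ.- p → p ℚ.≤ q
0≤q-p⇒p≤q {p} {q} 0≤q-p = subst₂ ℚ._≤_ (ℚ.+-identityˡ p)
  (solve 2 (λ p q → (q :- p) :+ p := q) refl p q) (ℚ.+-monoˡ-≤ p 0≤q-p)
  where open +-*-Solver

0≤½ : 0ℚ ℚ.≤ ½
0≤½ = ℚ.*≤* (ℤ.+≤+ z≤n)

-- Powers of φ and the floor of the logarithm

φ^-fib : ∀ j → φ ^ j ≡ (ι (fib j) ℚ.+ ½ ℚ.* ι (fib (suc j))) + ½ ℚ.* ι (fib (suc j)) √5
φ^-fib zero    = refl
-- Since φ² = φ + 1, multiplication by φ sends `a` + `b` φ to `b` + (`b` + `a`) φ.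
φ^-fib (suc j) = trans (cong (φ *_) (φ^-fib j)) (cong₂ _+_√5
  (trans (solve 2 (λ a b →
      con ½ :* (a :+ con ½ :* b) :+ con 5ℚ :* (con ½ :* (con ½ :* b)) := b :+ con ½ :* (b :+ a))
      refl a b)
    (cong (λ c → b ℚ.+ ½ ℚ.* c) b+a))
  (trans (solve 2 (λ a b →
      con ½ :* (con ½ :* b) :+ con ½ :* (a :+ con ½ :* b) := con ½ :* (b :+ a))
      refl a b)
    (cong (½ ℚ.*_) b+a)))
  where
  open +-*-Solver
  a = ι (fib j)
  b = ι (fib (suc j))

  b+a : b ℚ.+ a ≡ ι (fib (2 ℕ.+ j))
  b+a = sym (ι-+ (fib (suc j)) (fib j))

-- φ² < 3, so φ^j = F_{j-1} + F_j φ ≤ F_{j-1} + 2 F_j = F_{j+2}.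
φ^≤fib : ∀ j {n} → fib (3 ℕ.+ j) ≤ n → φ ^ j ≤√5 fromℕ n
φ^≤fib j {n} bound = subst (_≤√5 fromℕ n) (sym (φ^-fib j)) (inj₁ (0≤c , 5d²≤c²))
  where
  open +-*-Solver
  a = ι (fib j)
  b = ι (fib (suc j))
  -- `b + a + b` is `fib (3 + j)`, so `e` is the slack in `bound`; `c` and `d` are the coordinates
  -- of n - φ^j.
  e = ι n ℚ.- (b ℚ.+ a ℚ.+ b)
  c = ι n ℚ.- (a ℚ.+ ½ ℚ.* b)
  d = 0ℚ ℚ.- ½ ℚ.* b
  3ℚ = ι 3

  0≤b : 0ℚ ℚ.≤ b
  0≤b = 0≤ι (fib (suc j))

  0≤e : 0ℚ ℚ.≤ e
  0≤e = p≤q⇒0≤q-p (subst (ℚ._≤ ι n)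
    (trans (ι-+ (fib (2 ℕ.+ j)) (fib (suc j))) (cong (ℚ._+ b) (ι-+ (fib (suc j)) (fib j))))
    (ι-mono-≤ {fib (3 ℕ.+ j)} {n} bound))

  0≤c : 0ℚ ℚ.≤ c
  0≤c = subst (0ℚ ℚ.≤_)
    (solve 3 (λ a b n → (n :- (b :+ a :+ b)) :+ con 3ℚ :* (con ½ :* b) := n :- (a :+ con ½ :* b))
      refl a b (ι n))
    (0≤p+q 0≤e (0≤p*q (0≤ι 3) (0≤p*q 0≤½ 0≤b)))

  5d²≤c² : 5ℚ ℚ.* (d ℚ.* d) ℚ.≤ c ℚ.* c
  -- With c = e + 3b/2 and d = -b/2, the difference c² - 5d² equals b² + 3be + e².
  5d²≤c² = 0≤q-p⇒p≤q (subst (0ℚ ℚ.≤_)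
    (solve 3 (λ a b n →
        let e = n :- (b :+ a :+ b)
            c = n :- (a :+ con ½ :* b)
            d = con 0ℚ :- con ½ :* b
        in  b :* b :+ (con 3ℚ :* (b :* e) :+ e :* e) := c :* c :- con 5ℚ :* (d :* d))
      refl a b (ι n))
    (0≤p+q (0≤p*q 0≤b 0≤b) (0≤p+q (0≤p*q (0≤ι 3) (0≤p*q 0≤b 0≤e)) (0≤p*q 0≤e 0≤e))))

-- Both coordinates of the difference are nonnegative, so whichever square dominates selects the
-- disjunct of `NonNegative`.
rational-≤√5 : ∀ {p x y} → p ℚ.≤ x → 0ℚ ℚ.≤ y → p + 0ℚ √5 ≤√5 x + y √5
rational-≤√5 {p} {x} {y} p≤x 0≤y =
  by (ℚ.≤-total (5ℚ ℚ.* (d ℚ.* d)) (c ℚ.* c))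
  where
  c = x ℚ.- p
  d = y ℚ.- 0ℚ

  by : 5ℚ ℚ.* (d ℚ.* d) ℚ.≤ c ℚ.* c ⊎ c ℚ.* c ℚ.≤ 5ℚ ℚ.* (d ℚ.* d) → p + 0ℚ √5 ≤√5 x + y √5
  by (inj₁ le) = inj₁ (p≤q⇒0≤q-p p≤x , le)
  by (inj₂ ge) = inj₂ (p≤q⇒0≤q-p 0≤y , ge)

rational-≤√5-total : ∀ p x {y} → 0ℚ ℚ.≤ y → p + 0ℚ √5 ≤√5 x + y √5 ⊎ x + y √5 ≤√5 p + 0ℚ √5
rational-≤√5-total p x {y} 0≤y
  with ℚ.≤-total p x | ℚ.≤-total ((x ℚ.- p) ℚ.* (x ℚ.- p)) (5ℚ ℚ.* ((y ℚ.- 0ℚ) ℚ.* (y ℚ.- 0ℚ)))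
... | inj₁ p≤x | _       = inj₁ (rational-≤√5 p≤x 0≤y)
... | inj₂ _   | inj₁ le = inj₁ (inj₂ (p≤q⇒0≤q-p 0≤y , le))
-- The reversed difference has both coordinates negated, which leaves their squares unchanged.
... | inj₂ x≤p | inj₂ ge = inj₂ (inj₁ (p≤q⇒0≤q-p x≤p , subst₂ ℚ._≤_
  (solve 1 (λ y → con 5ℚ :* ((y :- con 0ℚ) :* (y :- con 0ℚ)) := con 5ℚ :* ((con 0ℚ :- y) :* (con 0ℚ :- y))) refl y)
  (solve 2 (λ p x → (x :- p) :* (x :- p) := (p :- x) :* (p :- x)) refl p x) ge))
  where open +-*-Solver

φ^-≤√5-total : ∀ n j → fromℕ n ≤√5 φ ^ j ⊎ φ ^ j ≤√5 fromℕ n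
φ^-≤√5-total n j = subst (λ z → fromℕ n ≤√5 z ⊎ z ≤√5 fromℕ n) (sym (φ^-fib j))
  (rational-≤√5-total (ι n) _ (0≤p*q 0≤½ (0≤ι (fib (suc j)))))

fromℕ≤φ^ : ∀ {n} j → n ≤ fib j → fromℕ n ≤√5 φ ^ j
fromℕ≤φ^ {n} j n≤fib = subst (fromℕ n ≤√5_) (sym (φ^-fib j)) (rational-≤√5 n≤x 0≤y)
  where
  0≤y : 0ℚ ℚ.≤ ½ ℚ.* ι (fib (suc j))
  0≤y = 0≤p*q 0≤½ (0≤ι (fib (suc j)))

  n≤x : ι n ℚ.≤ ι (fib j) ℚ.+ ½ ℚ.* ι (fib (suc j))
  n≤x = subst (ℚ._≤ ι (fib j) ℚ.+ ½ ℚ.* ι (fib (suc j))) (ℚ.+-identityʳ (ι n))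
    (ℚ.+-mono-≤ (ι-mono-≤ {n} {fib j} n≤fib) 0≤y)

-- The √5-coordinate of φ^(j+1) is at least ½. The successor matters, as φ^0 is `fromℕ 1`.
fromℕ≢φ^ : ∀ n j → fromℕ n ≢ φ ^ suc j
fromℕ≢φ^ n j eq = absurd (subst (½ ℚ.≤_) (sym (cong ℚ[√5].irrational (trans eq (φ^-fib (suc j)))))
  (ℚ.*-monoˡ-≤-nonNeg ½ (ι-mono-≤ {1} {fib (2 ℕ.+ j)} (fib-positive j))))
  where
  absurd : ¬ (½ ℚ.≤ 0ℚ)
  absurd (ℚ.*≤* (ℤ.+≤+ ()))

floorLogφ-above : ∀ n k → φ ^ k ≤√5 fromℕ n → ∃[ m ] IsFloorLogφ n m × k ≤ m
floorLogφ-above n k lower = search (suc n) k lower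
  -- The starting upper bound is n ≤ n + k ≤ `fib (2 + n + k)`.
  (fromℕ≤φ^ (2 ℕ.+ n ℕ.+ k) (ℕ.≤-trans (ℕ.m≤m+n n k) (n≤fib (n ℕ.+ k))))
  where
  -- The window from exponent `k` to `suc d + k` brackets `n`, and its lower end only moves up. At
  -- width one the upper inequality is strict by `fromℕ≢φ^`.
  search : ∀ d k → φ ^ k ≤√5 fromℕ n → fromℕ n ≤√5 φ ^ (suc d ℕ.+ k) → ∃[ m ] IsFloorLogφ n m × k ≤ m
  search zero    k lower upper = k , (lower , upper , fromℕ≢φ^ n k) , ℕ.≤-refl
  search (suc d) k lower upper = by (φ^-≤√5-total n (suc k))
    where
    by : fromℕ n ≤√5 φ ^ suc k ⊎ φ ^ suc k ≤√5 fromℕ n → ∃[ m ] IsFloorLogφ n m × k ≤ m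
    by (inj₁ upper′) = k , (lower , upper′ , fromℕ≢φ^ n k) , ℕ.≤-refl
    by (inj₂ lower′) =
      let m , floor , k<m = search d (suc k) lower′
            (subst (λ i → fromℕ n ≤√5 φ ^ i) (sym (ℕ.+-suc (suc d) k)) upper)
      in  m , floor , ℕ.<⇒≤ k<m

theorem2 : {C : Set} (_≟_ : DecidableEquality C) (G : ColouredGraph C) →
    Connected G → ConstantColouring G →
    (∃[ H ] order H ≡ 1 × ConvergesTo (iterated _≟_ G) H) ×
    (∃[ k ] IsNumberOfIterations _≟_ G k ×
    (∃[ m ] IsFloorLogφ (order G) m × k ≤ m))
theorem2 _≟_ G connected constant =
  let k , least , bound = fib-descent (order ∘ iterated _≟_ G)
        (λ i → proj₁ (iterated-connected _≟_ G connected i))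
        (λ i → order-/β² _≟_ (iterated _≟_ G i) (iterated-connected _≟_ G connected i)
                 (iterated-colours-equal _≟_ G constant i i))
  -- The first graph of order 1 serves as the limit, and its index as the threshold of convergence.
  in  ( iterated _≟_ G k , proj₁ least , k , λ l k≤l → single-vertex-≋ _ _
          (order≡1-stable _≟_ G connected (proj₁ least) (ℕ.≤⇒≤′ k≤l)) (proj₁ least)
          (iterated-colours-equal _≟_ G constant l k))
    , (k , least , floorLogφ-above (order G) k (φ^≤fib k bound))
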